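{- For every integer $x_0\ge1$ and every $m\in\mathbb{N}$, $$P(w,m)=\#\{\,x_n\bmod 2^m : n\ge0\,\},$$ where $(x_n)_{n\ge0}$ and $w$ are the orbit and the word associated with $x_0$.
   Context: Here $\mathbb{N}=\{0,1,2,\dots\}$. For an integer $x_0\ge1$ the orbit is defined by $x_{n+1}=\lceil 3x_n/2\rceil$ for $n\ge0$, and the word $w=(w_n)_{n\ge0}$ by $w_n=x_n\bmod 2\in\{0,1\}$; equivalently $w_n=2x_{n+1}-3x_n$. The complexity $P(w,m)$ is the number of distinct vectors $(w_j,w_{j+1},\dots,w_{j+m-1})$ as $j$ ranges over all non-negative integers. -}

module Defs where

open import Data.Fin.Base using (Fin; toℕ)
open import Data.List.Base using (List; []; _∷_; length; allFin; cartesianProductWith)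
open import Data.List.Membership.Propositional using (_∈_)
open import Data.List.Membership.Propositional.Properties
  using (∈-allFin; ∈-cartesianProductWith⁺)
open import Data.List.Membership.Propositional.Properties.WithK using (unique∧set⇒bag)
open import Data.List.Relation.Binary.BagAndSetEquality using (∼bag⇒↭)
open import Data.List.Relation.Binary.Permutation.Propositional.Properties using (↭-length)
open import Data.List.Relation.Unary.All.Properties.Core using (¬Any⇒All¬)
open import Data.List.Relation.Unary.Any using (here; there)
open import Data.List.Relation.Unary.AllPairs using ([]; _∷_)
open import Data.List.Relation.Unary.Unique.Propositional using (Unique)
open import Data.Nat.Base using (ℕ; zero; suc; _+_; _*_; _^_; ⌈_/2⌉)
open import Data.Nat.DivMod using (_mod_)
open import Data.Nat.Properties using (m^n≢0)
open import Data.Product.Base using (_×_; _,_; ∃)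
open import Data.Vec.Base using (Vec; []; _∷_; tabulate)
open import Function.Bundles using (_⇔_; mk⇔)
open import Function.Construct.Composition using (_⇔-∘_)
open import Function.Construct.Symmetry using (⇔-sym)
open import Relation.Binary.PropositionalEquality using (_≡_; refl)
open import Relation.Nullary using (¬_; yes; no; contradiction)
open import Relation.Nullary.Decidable.Core using (¬¬-excluded-middle)

orbit : ℕ → ℕ → ℕ
orbit x₀ zero    = x₀
orbit x₀ (suc n) = ⌈ 3 * orbit x₀ n /2⌉

word : ℕ → ℕ → Fin 2
word x₀ n = orbit x₀ n mod 2

residue : ℕ → (m : ℕ) → ℕ → Fin (2 ^ m)
residue x₀ m n = _mod_ (orbit x₀ n) (2 ^ m) {{m^n≢0 2 m}}

factor : {A : Set} → (ℕ → A) → (m : ℕ) → ℕ → Vec A m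
factor w m j = tabulate (λ i → w (j + toℕ i))

Range : {A : Set} → (ℕ → A) → A → Set
Range f a = ∃ λ n → f n ≡ a

-- The cardinality of a set is a relation rather than a function: the range of
-- an infinite sequence cannot in general be counted constructively, even when
-- it lies in a finite type.  The relation is functional
-- (HasCardinality-unique), and for a sequence in a finite type a cardinality
-- exists up to double negation (¬¬-HasCardinality).
HasCardinality : {A : Set} → (A → Set) → ℕ → Set
HasCardinality {A} S k =
  ∃ λ (xs : List A) → Unique xs × length xs ≡ k × (∀ a → a ∈ xs ⇔ S a)

-- Complexity w m k  means  P(w , m) = k.
Complexity : {A : Set} → (ℕ → A) → ℕ → ℕ → Set
Complexity w m = HasCardinality (Range (factor w m))

HasCardinality-unique : {A : Set} {S : A → Set} {k l : ℕ} →
  HasCardinality S k → HasCardinality S l → k ≡ l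
HasCardinality-unique (xs , xs! , refl , xs⇔) (ys , ys! , refl , ys⇔) =
  ↭-length (∼bag⇒↭ (unique∧set⇒bag xs! ys!
    (λ {a} → ⇔-sym (ys⇔ a) ⇔-∘ xs⇔ a)))

¬¬-HasCardinality : {A : Set} {S : A → Set} (xs : List A) →
  (∀ a → S a → a ∈ xs) → ¬ ¬ (∃ (HasCardinality S))
¬¬-HasCardinality {A} {S} xs S⊆xs ¬card =
  select xs λ (ys , ys! , ys⊆S , ys⊇) →
    ¬card (length ys , ys , ys! , refl ,
           λ a → mk⇔ (ys⊆S a) (λ s → ys⊇ a (S⊆xs a s) s))
  where
  Selection : List A → Set
  Selection zs = ∃ λ (ys : List A) →
    Unique ys × (∀ a → a ∈ ys → S a) × (∀ a → a ∈ zs → S a → a ∈ ys)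

  select : (zs : List A) → ¬ ¬ Selection zs
  select [] ¬sel = ¬sel ([] , [] , (λ _ ()) , (λ _ ()))
  select (z ∷ zs) ¬sel = select zs λ (ys , ys! , ys⊆S , ys⊇) →
    ¬¬-excluded-middle λ where
      (no ¬s) → ¬sel (ys , ys! , ys⊆S , λ where
        _ (here refl) s → contradiction s ¬s
        a (there a∈)  s → ys⊇ a a∈ s)
      (yes s) → ¬¬-excluded-middle λ where
        (yes z∈ys) → ¬sel (ys , ys! , ys⊆S , λ where
          _ (here refl) _ → z∈ys
          a (there a∈)  t → ys⊇ a a∈ t)
        (no z∉ys) → ¬sel
          ( z ∷ ys
          , ¬Any⇒All¬ ys z∉ys ∷ ys!
          , (λ { _ (here refl) → s ; a (there a∈) → ys⊆S a a∈ })
          , (λ { _ (here refl) _ → here refl ; a (there a∈) t → there (ys⊇ a a∈ t) }))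

¬¬-residues : ∀ x₀ m → ¬ ¬ (∃ (HasCardinality (Range (residue x₀ m))))
¬¬-residues x₀ m = ¬¬-HasCardinality (allFin _) (λ a _ → ∈-allFin a)

¬¬-complexity : ∀ {k} (w : ℕ → Fin k) m → ¬ ¬ (∃ (Complexity w m))
¬¬-complexity {k} w m = ¬¬-HasCardinality (words m) (λ v _ → ∈-words v)
  where
  words : ∀ l → List (Vec (Fin k) l)
  words zero    = [] ∷ []
  words (suc l) = cartesianProductWith _∷_ (allFin k) (words l)

  ∈-words : ∀ {l} (v : Vec (Fin k) l) → v ∈ words l
  ∈-words []      = here refl
  ∈-words (a ∷ v) = ∈-cartesianProductWith⁺ _∷_ (∈-allFin a) (∈-words v)

{-# OPTIONS --safe #-}

-- If x and y have the same parity, then the step T x = ⌈3x/2⌉ satisfies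
-- 2 (T x − T y) = 3 (x − y).  Since 3 is invertible modulo powers of 2, by
-- induction on m two orbits share their first m parities iff their starting
-- points agree modulo 2ᵐ.  Hence the factor of length m at position j and the
-- residue of x_j modulo 2ᵐ determine each other, and the two sets of values
-- are in bijection.

module Submission where

open import Defs
open import Data.List.Base using (List; []; _∷_; map)
open import Data.List.Membership.Propositional using (_∈_)
open import Data.List.Membership.Propositional.Properties using (∈-map⁺; ∈-map⁻)
open import Data.List.Properties using (length-map)
open import Data.List.Relation.Unary.AllPairs as AllPairs using ()
import Data.List.Relation.Unary.AllPairs.Properties as AllPairs
open import Data.List.Relation.Unary.Any using (here; there)
open import Data.Fin.Base using (toℕ)
open import Data.Fin.Properties using (fromℕ<-cong; fromℕ<-injective)
open import Data.Nat.Base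
  using (ℕ; zero; suc; _+_; _*_; _^_; _≤_; ∣_-_∣; ⌈_/2⌉; NonZero)
open import Data.Nat.Coprimality using (Coprime; coprime-divisor; coprime?)
open import Data.Nat.Divisibility
  using (_∣_; divides-refl; 1∣_; ∣-trans; ∣n⇒∣m*n; m∣m*n; *-monoʳ-∣; *-cancelˡ-∣; ∣1⇒≡1)
open import Data.Nat.DivMod
  using (_mod_; _%_; _/_; m%n<n; m≡m%n+[m/n]*n; %-remove-+ʳ; [m+kn]%n≡m%n)
open import Data.Nat.Properties
open import Data.Product.Base using (∃; _,_)
open import Data.Sum.Base using (inj₁; inj₂)
open import Data.Vec.Base using ([]; _∷_)
open import Data.Vec.Properties using (tabulate-cong; ∷-injectiveˡ; ∷-injectiveʳ)
open import Function.Base using (_∘_)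
open import Function.Bundles using (_⇔_; mk⇔; module Equivalence)
open import Function.Construct.Composition using (_⇔-∘_)
open import Function.Construct.Symmetry using (⇔-sym)
open import Relation.Binary.PropositionalEquality
  using (_≡_; refl; sym; trans; cong; cong₂; subst; module ≡-Reasoning)
open import Relation.Nullary.Decidable using (from-yes)

open Equivalence using (to; from)

private
  variable
    A B : Set

-- Choosing indices turns a listing of the range of `f` into `map f ns`, so that the same `ns` can
-- be fed to another sequence.
preimages : (f : ℕ → A) (xs : List A) → (∀ {a} → a ∈ xs → Range f a) →
  ∃ λ ns → map f ns ≡ xs
preimages f []       _ = [] , refl
preimages f (x ∷ xs) r with r (here refl) | preimages f xs (r ∘ there)
... | n , fn≡x | ns , fns≡xs = n ∷ ns , cong₂ _∷_ fn≡x fns≡xs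

-- The indices listing the range of `f` also list that of `g`: the backward half of the hypothesis
-- keeps the entries distinct, the forward half makes the list exhaustive.
HasCardinality-Range : {f : ℕ → A} {g : ℕ → B} →
  (∀ i j → f i ≡ f j ⇔ g i ≡ g j) → ∀ {k} →
  HasCardinality (Range f) k → HasCardinality (Range g) k
HasCardinality-Range {f = f} {g} f⇔g (xs , xs! , refl , xs⇔)
  with ns , refl ← preimages f xs (λ {a} → to (xs⇔ a))
  = map g ns
  , AllPairs.map⁺ (AllPairs.map (λ f≢ → f≢ ∘ from (f⇔g _ _)) (AllPairs.map⁻ xs!))
  , trans (length-map g ns) (sym (length-map f ns))
  , λ b → mk⇔ ∈⇒Range (λ { (n , refl) → Range⇒∈ n })
  where
  ∈⇒Range : ∀ {b} → b ∈ map g ns → Range g b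
  ∈⇒Range b∈ with n , _ , refl ← ∈-map⁻ g b∈ = n , refl

  Range⇒∈ : ∀ n → g n ∈ map g ns
  Range⇒∈ n with n′ , n′∈ , fn≡ ← ∈-map⁻ f (from (xs⇔ (f n)) (n , refl)) =
    subst (_∈ map g ns) (sym (to (f⇔g n n′) fn≡)) (∈-map⁺ g n′∈)

-- Distance replaces the integer difference; its symmetry reduces the converse to ordered pairs.
mod-≡⇔∣ : ∀ x y d .{{_ : NonZero d}} → x mod d ≡ y mod d ⇔ d ∣ ∣ x - y ∣
mod-≡⇔∣ x y d = mk⇔
  (λ eq → ⇒ (fromℕ<-injective _ _ (m%n<n x d) (m%n<n y d) eq))
  (λ d∣ → fromℕ<-cong _ _ (⇐ d∣) (m%n<n x d) (m%n<n y d))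
  where
  open ≡-Reasoning

  ⇒ : x % d ≡ y % d → d ∣ ∣ x - y ∣
  ⇒ eq = subst (d ∣_) (sym distance) (divides-refl ∣ x / d - y / d ∣)
    where
    distance : ∣ x - y ∣ ≡ ∣ x / d - y / d ∣ * d
    distance = begin
      ∣ x - y ∣
        ≡⟨ cong₂ ∣_-_∣ (m≡m%n+[m/n]*n x d)
             (trans (m≡m%n+[m/n]*n y d) (cong (_+ y / d * d) (sym eq))) ⟩
      ∣ x % d + x / d * d - x % d + y / d * d ∣
        ≡⟨ ∣m+n-m+o∣≡∣n-o∣ (x % d) _ _ ⟩
      ∣ x / d * d - y / d * d ∣
        ≡⟨ *-distribʳ-∣-∣ d (x / d) (y / d) ⟨
      ∣ x / d - y / d ∣ * d
        ∎

  ≤⇐ : ∀ {m n} → m ≤ n → d ∣ ∣ m - n ∣ → m % d ≡ n % d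
  ≤⇐ {m} m≤n d∣ with o , refl ← m≤n⇒∃[o]m+o≡n m≤n =
    sym (%-remove-+ʳ m (subst (d ∣_) (∣m-m+n∣≡n m o) d∣))

  ⇐ : d ∣ ∣ x - y ∣ → x % d ≡ y % d
  ⇐ d∣ with ≤-total x y
  ... | inj₁ x≤y = ≤⇐ x≤y d∣
  ... | inj₂ y≤x = sym (≤⇐ y≤x (subst (d ∣_) (∣-∣-comm x y) d∣))

-- A divisor of `n` is itself coprime to `m`, so one factor `m` at a time can be stripped from the
-- power.
coprime-^ˡ : ∀ {m n} k → Coprime m n → Coprime (m ^ k) n
coprime-^ˡ zero    _ (d∣1 , _) = ∣1⇒≡1 d∣1
coprime-^ˡ (suc k) c (d∣m^k , d∣n) = coprime-^ˡ k c
  ( coprime-divisor (λ (e∣d , e∣m) → c (e∣m , ∣-trans e∣d d∣n)) d∣m^k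
  , d∣n)

2*⌈n/2⌉ : ∀ n → 2 * ⌈ n /2⌉ ≡ n % 2 + n
2*⌈n/2⌉ 0             = refl
2*⌈n/2⌉ 1             = refl
2*⌈n/2⌉ (suc (suc n)) = begin
  2 * suc ⌈ n /2⌉        ≡⟨ *-suc 2 ⌈ n /2⌉ ⟩
  2 + 2 * ⌈ n /2⌉        ≡⟨ cong (2 +_) (2*⌈n/2⌉ n) ⟩
  2 + (n % 2 + n)        ≡⟨ +-suc (suc (n % 2)) n ⟨
  suc (n % 2) + suc n    ≡⟨ +-suc (n % 2) (suc n) ⟨
  -- `suc (suc n) % 2` computes to `n % 2`.
  n % 2 + suc (suc n)    ∎
  where open ≡-Reasoning

step : ℕ → ℕ
step x = ⌈ 3 * x /2⌉

-- Rounding up adds the parity of `3 * x`, which is that of `x` because `3 * x` is `x + x * 2`.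
2*step : ∀ x → 2 * step x ≡ x % 2 + 3 * x
2*step x = trans (2*⌈n/2⌉ (3 * x)) (cong (_+ 3 * x)
  (trans (cong (λ z → (x + z) % 2) (*-comm 2 x)) ([m+kn]%n≡m%n x x 2)))

step-distance : ∀ x y → x % 2 ≡ y % 2 → 2 * ∣ step x - step y ∣ ≡ 3 * ∣ x - y ∣
step-distance x y eq = begin
  2 * ∣ step x - step y ∣              ≡⟨ *-distribˡ-∣-∣ 2 (step x) (step y) ⟩
  ∣ 2 * step x - 2 * step y ∣          ≡⟨ cong₂ ∣_-_∣ (2*step x)
                                           (trans (2*step y) (cong (_+ 3 * y) (sym eq))) ⟩
  ∣ x % 2 + 3 * x - x % 2 + 3 * y ∣    ≡⟨ ∣m+n-m+o∣≡∣n-o∣ (x % 2) (3 * x) (3 * y) ⟩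
  ∣ 3 * x - 3 * y ∣                    ≡⟨ *-distribˡ-∣-∣ 3 x y ⟨
  3 * ∣ x - y ∣                        ∎
  where open ≡-Reasoning

-- In `step-distance` the factor 2 accounts for the extra power of 2, while the factor 3 is coprime
-- to it and can be cancelled.
step-∣ : ∀ m x y → x % 2 ≡ y % 2 →
  2 ^ m ∣ ∣ step x - step y ∣ ⇔ 2 ^ suc m ∣ ∣ x - y ∣
step-∣ m x y eq = mk⇔
  (λ d → coprime-divisor (coprime-^ˡ (suc m) (from-yes (coprime? 2 3)))
    (subst (2 ^ suc m ∣_) (step-distance x y eq) (*-monoʳ-∣ 2 d)))
  (λ d → *-cancelˡ-∣ 2
    (subst (2 ^ suc m ∣_) (sym (step-distance x y eq)) (∣n⇒∣m*n 3 d)))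

orbit-+ : ∀ x j i → orbit x (j + i) ≡ orbit (orbit x j) i
orbit-+ x j zero    = cong (orbit x) (+-identityʳ j)
orbit-+ x j (suc i) = trans (cong (orbit x) (+-suc j i)) (cong step (orbit-+ x j i))

-- The orbit from time `j` on is the orbit started at `orbit x j`, so only prefixes need to be
-- compared.
factor-shift : ∀ x m j → factor (word x) m j ≡ factor (word (orbit x j)) m 0
factor-shift x m j = tabulate-cong λ i → cong (_mod 2) (orbit-+ x j (toℕ i))

-- Both starting points vary, since the induction moves on to `step x` and `step y`.
prefix-≡⇔∣ : ∀ m x y →
  factor (word x) m 0 ≡ factor (word y) m 0 ⇔ 2 ^ m ∣ ∣ x - y ∣
prefix-≡⇔∣ zero    x y = mk⇔ (λ _ → 1∣ _) (λ _ → refl)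
prefix-≡⇔∣ (suc m) x y = mk⇔ ⇒ ⇐
  where
  parity : x mod 2 ≡ y mod 2 → x % 2 ≡ y % 2
  parity = fromℕ<-injective _ _ (m%n<n x 2) (m%n<n y 2)

  ⇒ : _ → _
  ⇒ eq = to (step-∣ m x y (parity (∷-injectiveˡ eq)))
    (to (prefix-≡⇔∣ m (step x) (step y))
      -- The tail of the prefix is the factor at position 1, and `orbit x 1` is `step x`.
      (trans (sym (factor-shift x m 1)) (trans (∷-injectiveʳ eq) (factor-shift y m 1))))

  ⇐ : _ → _
  ⇐ d = cong₂ _∷_ head≡
    (trans (factor-shift x m 1)
      (trans (from (prefix-≡⇔∣ m (step x) (step y)) (from (step-∣ m x y (parity head≡)) d))
        (sym (factor-shift y m 1))))
    where
    head≡ : x mod 2 ≡ y mod 2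
    -- Since 2 divides `2 ^ suc m`, the first letters agree; `step-∣` needs this parity.
    head≡ = from (mod-≡⇔∣ x y 2) (∣-trans (m∣m*n (2 ^ m)) d)

factor-≡⇔residue-≡ : ∀ x₀ m i j →
  factor (word x₀) m i ≡ factor (word x₀) m j ⇔ residue x₀ m i ≡ residue x₀ m j
factor-≡⇔residue-≡ x₀ m i j
  rewrite factor-shift x₀ m i | factor-shift x₀ m j =
  ⇔-sym (mod-≡⇔∣ (orbit x₀ i) (orbit x₀ j) (2 ^ m) {{m^n≢0 2 m}})
  ⇔-∘ prefix-≡⇔∣ m (orbit x₀ i) (orbit x₀ j)

proposition4p3 : (x₀ : ℕ) → 1 ≤ x₀ → (m k : ℕ) →
    Complexity (word x₀) m k ⇔ HasCardinality (Range (residue x₀ m)) k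
proposition4p3 x₀ _ m k = mk⇔
  (HasCardinality-Range (factor-≡⇔residue-≡ x₀ m))
  (HasCardinality-Range λ i j → ⇔-sym (factor-≡⇔residue-≡ x₀ m i j))
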